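{- For any finite word $w$, let $S(w)$ denote the number of distinct square factors of $w$ (the empty word being counted as a square), let $|w|$ denote the length of $w$, and let $|\mathrm{Alph}(w)|$ denote the number of distinct letters occurring in $w$. Then $$S(w)\le |w|-|\mathrm{Alph}(w)|+1.$$
   Context: A word is a finite sequence of symbols $w=w_1w_2\cdots w_n$; its length is $|w|=n$, and $\varepsilon$ denotes the empty word, of length $0$. $\mathrm{Alph}(w)=\{w_i : 1\le i\le n\}$ is the set of letters occurring in $w$. A word $u$ is a factor of $w$ if $w=pus$ for some (possibly empty) words $p,s$. A square is a word of the form $uu$; the empty word $\varepsilon=\varepsilon\varepsilon$ is a square and is counted in $S(w)$, so that $S(w)-1$ is the number of distinct nonempty squares that are factors of $w$. -}

module Defs where

open import Level using (Level)
open import Data.List using (List; []; _∷_; _++_; length; take; concatMap; inits; tails; filter; deduplicate)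
open import Data.List.Properties using (≡-dec; length-++)
open import Data.List.Membership.Propositional using (_∈_; find; lose)
open import Data.List.Membership.Propositional.Properties
  using (∈-map⁺; ∈-map⁻; ∈-concatMap⁺; ∈-concatMap⁻; ∈-filter⁺; ∈-filter⁻; ∈-deduplicate⁺; ∈-deduplicate⁻)
open import Data.List.Relation.Unary.Any using (here; there)
open import Data.List.Relation.Unary.Unique.Propositional using (Unique)
import Data.List.Relation.Unary.Unique.DecPropositional.Properties as UniqueDec
open import Data.Nat using (ℕ; ⌊_/2⌋)
open import Data.Nat.Properties using (n≡⌊n+n/2⌋)
open import Data.Product using (∃; ∃₂; _×_; _,_)
open import Function using (_⇔_; mk⇔)
open import Relation.Binary.Definitions using (DecidableEquality)
open import Relation.Binary.PropositionalEquality using (_≡_; refl; sym; trans; cong)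
open import Relation.Nullary.Decidable using (map′)
open import Relation.Unary using (Decidable)

private
  variable
    a : Level
    A : Set a

Word : Set a → Set a
Word A = List A

Factor : {A : Set a} → Word A → Word A → Set a
Factor u w = ∃₂ λ p s → w ≡ p ++ u ++ s

Square : {A : Set a} → Word A → Set a
Square x = ∃ λ u → x ≡ u ++ u

-- One entry per occurrence, so the list has repetitions.
factors : Word A → List (Word A)
factors w = concatMap inits (tails w)

private
  ∈-inits⁺ : (u s : Word A) → u ∈ inits (u ++ s)
  ∈-inits⁺ []      s = here refl
  ∈-inits⁺ (x ∷ u) s = there (∈-map⁺ (x ∷_) (∈-inits⁺ u s))

  ∈-inits⁻ : (u v : Word A) → u ∈ inits v → ∃ λ s → v ≡ u ++ s
  ∈-inits⁻ u v       (here refl) = v , refl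
  ∈-inits⁻ u (x ∷ v) (there u∈)  with ∈-map⁻ (x ∷_) u∈
  ... | u′ , u′∈ , refl with ∈-inits⁻ u′ v u′∈
  ... | s , refl = s , refl

  ∈-tails⁺ : (p v : Word A) → v ∈ tails (p ++ v)
  ∈-tails⁺ []      []      = here refl
  ∈-tails⁺ []      (_ ∷ _) = here refl
  ∈-tails⁺ (x ∷ p) v       = there (∈-tails⁺ p v)

  ∈-tails⁻ : (v w : Word A) → v ∈ tails w → ∃ λ p → w ≡ p ++ v
  ∈-tails⁻ v w       (here refl) = [] , refl
  ∈-tails⁻ v (x ∷ w) (there v∈)  with ∈-tails⁻ v w v∈
  ... | p , refl = x ∷ p , refl

  take-length-++ : (u s : Word A) → take (length u) (u ++ s) ≡ u
  take-length-++ []      s = refl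
  take-length-++ (x ∷ u) s = cong (x ∷_) (take-length-++ u s)

  half-square : (u : Word A) → take ⌊ length (u ++ u) /2⌋ (u ++ u) ≡ u
  half-square u = trans
    (cong (λ n → take n (u ++ u))
      (trans (cong ⌊_/2⌋ (length-++ u)) (sym (n≡⌊n+n/2⌋ (length u)))))
    (take-length-++ u u)

∈-factors : (u w : Word A) → u ∈ factors w ⇔ Factor u w
∈-factors u w = mk⇔ to from
  where
  to : u ∈ factors w → Factor u w
  to u∈ with find (∈-concatMap⁻ inits {xs = tails w} u∈)
  ... | v , v∈ , u∈v with ∈-tails⁻ v w v∈ | ∈-inits⁻ u v u∈v
  ... | p , refl | s , refl = p , s , refl

  from : Factor u w → u ∈ factors w
  from (p , s , refl) =
    ∈-concatMap⁺ inits (lose (∈-tails⁺ p (u ++ s)) (∈-inits⁺ u s))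

module _ {a} {A : Set a} (_≟_ : DecidableEquality A) where

  square? : Decidable (Square {A = A})
  square? x = map′ (h ,_) (λ where (u , refl) → cong (λ v → v ++ v) (sym (half-square u)))
                (≡-dec _≟_ x (h ++ h))
    where h = take ⌊ length x /2⌋ x

  squareFactors : Word A → List (Word A)
  squareFactors w = deduplicate (≡-dec _≟_) (filter square? (factors w))

  S : Word A → ℕ
  S w = length (squareFactors w)

  Alph : Word A → List A
  Alph w = deduplicate _≟_ w

  -- The duplicate-free lists squareFactors w and Alph w enumerate the intended
  -- sets, so their lengths are the cardinalities of these sets.

  ∈-squareFactors : ∀ x w → x ∈ squareFactors w ⇔ (Square x × Factor x w)
  ∈-squareFactors x w = mk⇔ to from
    where
    open Function.Equivalence (∈-factors x w) renaming (to to factor⁻; from to factor⁺)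

    to : x ∈ squareFactors w → Square x × Factor x w
    to x∈ with ∈-filter⁻ square? {xs = factors w} (∈-deduplicate⁻ (≡-dec _≟_) _ x∈)
    ... | x∈f , sq = sq , factor⁻ x∈f

    from : Square x × Factor x w → x ∈ squareFactors w
    from (sq , f) = ∈-deduplicate⁺ (≡-dec _≟_) (∈-filter⁺ square? (factor⁺ f) sq)

  squareFactors-unique : ∀ w → Unique (squareFactors w)
  squareFactors-unique w = UniqueDec.deduplicate-! (≡-dec _≟_) (filter square? (factors w))

  ∈-Alph : ∀ x w → x ∈ Alph w ⇔ x ∈ w
  ∈-Alph x w = mk⇔ (∈-deduplicate⁻ _≟_ w) (∈-deduplicate⁺ _≟_)

  Alph-unique : ∀ w → Unique (Alph w)
  Alph-unique w = UniqueDec.deduplicate-! _≟_ w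

{-# OPTIONS --safe #-}
module Submission where

-- In the Rauzy graph of order n the vertices and edges are the factors of w of length n and n + 1,
-- so a connected subgraph containing all vertices has at least C(n) - 1 edges. A circuit of length
-- p ≤ n consists of the factors of a p-periodic stream; its edge starting with the Lyndon rotation
-- has least period p, hence lies on no other circuit of length at most p. Removing these edges in
-- order of decreasing p therefore preserves connectedness, and there are at most
-- C(n+1) - C(n) + 1 of them; summed over 1 ≤ n < |w| this is at most |w| - |Alph(w)|.
-- Finally, if r + 1 windows of length (q+1)p of a p-periodic stream occur in w, then all its windows
-- of length q p + r + 1 occur, so the r-th such square (counting from 0) can be sent to the special
-- edge of the circuit of order q p + r, and this is injective.

open import Defs
open import Data.Bool using (if_then_else_)
open import Data.Empty using (⊥)
open import Data.Integer using (+_; _+_; _-_; _≤_; _⊖_; +≤+)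
import Data.Integer.Properties as ℤ
open import Data.List using (List; []; _∷_; _++_; length; map; take; drop; filter; applyUpTo; deduplicate)
open import Data.List.Properties
  using (length-applyUpTo; length-deduplicate; length-map; length-++; map-++; ≡-dec; ∷-injectiveˡ; ∷-injectiveʳ)
open import Data.List.Membership.Propositional using (_∈_)
open import Data.List.Membership.Propositional.Properties
open import Data.List.Relation.Unary.All as All using ([]; _∷_)
open import Data.List.Relation.Unary.Any using (here; there)
open import Data.List.Relation.Unary.AllPairs using ([]; _∷_)
open import Data.List.Relation.Unary.Unique.Propositional using (Unique)
import Data.List.Relation.Unary.Unique.Propositional.Properties as Unique
import Data.List.Relation.Unary.Unique.DecPropositional.Properties as UniqueDec
import Data.Nat as ℕ
open ℕ using (ℕ; zero; suc; _∸_; z≤n; s≤s; _%_; _/_)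
open import Data.Nat.DivMod using (m≡m%n+[m/n]*n; m%n<n; [m+n]%n≡m%n; [m+kn]%n≡m%n; m<n⇒m%n≡m)
open import Data.Nat.Induction using (<-rec)
open import Data.Nat.Properties
open import Data.Nat.Tactic.RingSolver using (solve-∀)
open import Data.Product using (∃; ∃₂; _×_; _,_; proj₂)
open import Data.Sum using (_⊎_; inj₁; inj₂; map₂)
open import Function using (_∘_; id; Equivalence)
open import Relation.Binary.Definitions using (DecidableEquality; tri<; tri≈; tri>)
open import Relation.Binary.PropositionalEquality
open import Relation.Nullary using (¬_; Dec; yes; no; does; ¬?; contradiction)
open import Relation.Nullary.Decidable using (map′; _×-dec_; decidable-stable; ¬¬-excluded-middle)

private
  infixl 6 _∔_
  infix 4 _≤ⁿ_ _<ⁿ_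
  _∔_ = ℕ._+_
  _≤ⁿ_ = ℕ._≤_
  _<ⁿ_ = ℕ._<_

-- Finite lists

-- Pigeonhole for a relation, so that partners need not be chosen by a function. The partner of the
-- head is deleted from `ys`; injectivity forbids the other elements to use that occurrence.
relation-length-≤ : ∀ {a b r} {A : Set a} {B : Set b} (R : A → B → Set r) {xs ys} → Unique xs →
  (∀ {x} → x ∈ xs → ∃ λ y → y ∈ ys × R x y) →
  (∀ {x x′ y} → x ∈ xs → x′ ∈ xs → R x y → R x′ y → x ≡ x′) →
  length xs ≤ⁿ length ys
relation-length-≤ R {[]} _ _ _ = z≤n
relation-length-≤ R {x ∷ xs} (x∉ ∷ uniq) total inj
  with y , y∈ , Rxy ← total (here refl)
  with as , bs , refl ← ∈-∃++ y∈ = begin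
    suc (length xs)              ≤⟨ s≤s (relation-length-≤ R uniq total′ λ p q → inj (there p) (there q)) ⟩
    suc (length (as ++ bs))      ≡⟨ cong suc (length-++ as) ⟩
    suc (length as ∔ length bs)  ≡⟨ +-suc (length as) (length bs) ⟨
    length as ∔ suc (length bs)  ≡⟨ length-++ as ⟨
    length (as ++ y ∷ bs)        ∎
  where
  open ≤-Reasoning
  total′ : ∀ {x′} → x′ ∈ xs → ∃ λ y′ → y′ ∈ as ++ bs × R x′ y′
  total′ x′∈ with total (there x′∈)
  ... | y′ , y′∈ , Rx′y′ with ∈-++⁻ as y′∈
  ... | inj₁ y′∈as = y′ , ∈-++⁺ˡ y′∈as , Rx′y′
  ... | inj₂ (there y′∈bs) = y′ , ∈-++⁺ʳ as y′∈bs , Rx′y′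
  ... | inj₂ (here refl) =
    contradiction (inj (here refl) (there x′∈) Rxy Rx′y′) (All.lookup x∉ x′∈)

-- Meant for `Special`, which quantifies over streams and comes with no decision procedure. The
-- double negation is removed at the end, where the goal is a decidable inequality.
¬¬-split : ∀ {a p} {A : Set a} (P : A → Set p) (xs : List A) →
  ¬ ¬ (∃₂ λ ys zs → length ys ∔ length zs ≡ length xs ×
        (∀ {x} → x ∈ xs → P x → x ∈ ys) × (∀ {x} → x ∈ xs → P x ⊎ x ∈ zs))
¬¬-split P [] k = k ([] , [] , refl , (λ ()) , (λ ()))
¬¬-split P (x ∷ xs) k = ¬¬-split P xs λ where
  (ys , zs , len , P⇒ , dich) → ¬¬-excluded-middle λ where
    (yes Px) → k (x ∷ ys , zs , cong suc len
      , (λ where (here refl) _ → here refl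
                 (there x∈) Px → there (P⇒ x∈ Px))
      , (λ where (here refl) → inj₁ Px
                 (there x∈) → dich x∈))
    (no ¬Px) → k (ys , x ∷ zs , trans (+-suc (length ys) _) (cong suc len)
      , (λ where (here refl) Px → contradiction Px ¬Px
                 (there x∈) Px → P⇒ x∈ Px)
      , (λ where (here refl) → inj₂ (here refl)
                 (there x∈) → map₂ there (dich x∈)))

-- Connectedness is expressed by functions: a graph is connected when every
-- function that agrees at the two ends of each edge is constant on the vertices.
connected⇒length-≤ : ∀ {a} {A : Set a} (_≟_ : DecidableEquality A) (es : List (A × A)) {n} → length es ≡ n →
  ∀ {vs : List A} → Unique vs →
  (∀ (g : A → A) → (∀ {a b} → (a , b) ∈ es → g a ≡ g b) → ∀ {x y} → x ∈ vs → y ∈ vs → g x ≡ g y) →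
  length vs ≤ⁿ suc n
connected⇒length-≤ _≟_ [] _ {[]} _ _ = z≤n
connected⇒length-≤ _≟_ [] _ {x ∷ []} _ _ = s≤s z≤n
-- Without edges even the identity is an admissible function, and it separates two distinct
-- vertices.
connected⇒length-≤ _≟_ [] _ {x ∷ y ∷ vs} ((x≢y ∷ _) ∷ _) conn =
  contradiction (conn id (λ ()) (here refl) (there (here refl))) x≢y
connected⇒length-≤ {A = A} _≟_ ((a , b) ∷ es) {suc n} len {vs} uniq conn = begin
  length vs                   ≤⟨ relation-length-≤ _≡_ uniq total (λ _ _ p q → trans p (sym q)) ⟩
  suc (length vs′)            ≤⟨ s≤s (connected⇒length-≤ _≟_ es′ len′ (Unique.filter⁺ (λ x → ¬? (x ≟ b)) uniq) conn′) ⟩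
  suc (suc n)                 ∎
  where
  open ≤-Reasoning
  -- Contracting the edge merges `b` into `a`. Functions on the contracted graph pull back to the
  -- original one, so connectedness survives with one edge fewer and at most one vertex fewer.
  contract : A → A
  contract x = if does (x ≟ b) then a else x

  vs′ = filter (λ x → ¬? (x ≟ b)) vs
  es′ = map (λ (x , y) → contract x , contract y) es

  len′ : length es′ ≡ n
  len′ = trans (length-map _ es) (suc-injective len)

  contract-fixes : ∀ {x} → ¬ x ≡ b → contract x ≡ x
  contract-fixes {x} x≢b with x ≟ b
  ... | yes x≡b = contradiction x≡b x≢b
  ... | no _    = refl

  contract-ends : contract a ≡ contract b
  contract-ends with a ≟ b | b ≟ b
  ... | _     | no b≢b = contradiction refl b≢b
  ... | yes _ | yes _  = refl
  ... | no _  | yes _  = refl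

  total : ∀ {x} → x ∈ vs → ∃ λ y → y ∈ b ∷ vs′ × x ≡ y
  total {x} x∈ with x ≟ b
  ... | yes x≡b = b , here refl , x≡b
  ... | no x≢b  = x , there (∈-filter⁺ _ x∈ x≢b) , refl

  conn′ : ∀ g → (∀ {x y} → (x , y) ∈ es′ → g x ≡ g y) → ∀ {x y} → x ∈ vs′ → y ∈ vs′ → g x ≡ g y
  conn′ g edge x∈′ y∈′
    with x∈ , x≢b ← ∈-filter⁻ (λ x → ¬? (x ≟ b)) {xs = vs} x∈′
       | y∈ , y≢b ← ∈-filter⁻ (λ x → ¬? (x ≟ b)) {xs = vs} y∈′ =
    trans (cong g (sym (contract-fixes x≢b)))
      (trans (conn (g ∘ contract) edge′ x∈ y∈) (cong g (contract-fixes y≢b)))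
    where
    edge′ : ∀ {x y} → (x , y) ∈ (a , b) ∷ es → g (contract x) ≡ g (contract y)
    edge′ (here refl) = cong g contract-ends
    edge′ (there e∈)  = edge (∈-map⁺ _ e∈)

-- Streams

Stream : Set
Stream = ℕ → ℕ

shift : ℕ → Stream → Stream
shift i f k = f (i ∔ k)

infix 4 _≈[_]_ _≺[_]_

_≈[_]_ : Stream → ℕ → Stream → Set
f ≈[ n ] g = ∀ {k} → k <ⁿ n → f k ≡ g k

-- Strict lexicographic order on prefixes of length `n`, witnessed by the first position of
-- difference.
_≺[_]_ : Stream → ℕ → Stream → Set
f ≺[ n ] g = ∃ λ k → k <ⁿ n × f k <ⁿ g k × f ≈[ k ] g

≈-sym : ∀ {n f g} → f ≈[ n ] g → g ≈[ n ] f
≈-sym eq k<n = sym (eq k<n)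

applyUpTo-cong : ∀ n {f g : Stream} → f ≈[ n ] g → applyUpTo f n ≡ applyUpTo g n
applyUpTo-cong zero    eq = refl
applyUpTo-cong (suc n) eq = cong₂ _∷_ (eq (s≤s z≤n)) (applyUpTo-cong n (eq ∘ s≤s))

applyUpTo-injective : ∀ n {f g : Stream} → applyUpTo f n ≡ applyUpTo g n → f ≈[ n ] g
applyUpTo-injective (suc n) eq {zero}  _         = ∷-injectiveˡ eq
applyUpTo-injective (suc n) eq {suc k} (s≤s k<n) = applyUpTo-injective n (∷-injectiveʳ eq) k<n

take-applyUpTo : ∀ {a} {A : Set a} n (f : ℕ → A) → take n (applyUpTo f (suc n)) ≡ applyUpTo f n
take-applyUpTo zero    f = refl
take-applyUpTo (suc n) f = cong (f 0 ∷_) (take-applyUpTo n (f ∘ suc))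

≺-asym : ∀ {m n f g} → f ≺[ m ] g → g ≺[ n ] f → ⊥
≺-asym (k , _ , fk<gk , f≈g) (l , _ , gl<fl , g≈f) with <-cmp k l
... | tri< k<l _ _ = <-irrefl (sym (g≈f k<l)) fk<gk
... | tri≈ _ refl _ = <-asym fk<gk gl<fl
... | tri> _ _ l<k = <-irrefl (sym (f≈g l<k)) gl<fl

≺-trans : ∀ {n f g h} → f ≺[ n ] g → g ≺[ n ] h → f ≺[ n ] h
≺-trans (k , k<n , fk<gk , f≈g) (l , l<n , gl<hl , g≈h) with <-cmp k l
... | tri< k<l _ _ = k , k<n , <-≤-trans fk<gk (≤-reflexive (g≈h k<l))
                   , λ i<k → trans (f≈g i<k) (g≈h (<-trans i<k k<l))
... | tri≈ _ refl _ = k , k<n , <-trans fk<gk gl<hl , λ i<k → trans (f≈g i<k) (g≈h i<k)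
... | tri> _ _ l<k = l , l<n , ≤-<-trans (≤-reflexive (f≈g l<k)) gl<hl
                   , λ i<l → trans (f≈g (<-trans i<l l<k)) (g≈h i<l)

≺-respʳ : ∀ {n f g h} → g ≈[ n ] h → f ≺[ n ] g → f ≺[ n ] h
≺-respʳ g≈h (k , k<n , fk<gk , f≈g) =
  k , k<n , <-≤-trans fk<gk (≤-reflexive (g≈h k<n)) , λ i<k → trans (f≈g i<k) (g≈h (<-trans i<k k<n))

≺-respˡ : ∀ {n f g h} → f ≈[ n ] h → f ≺[ n ] g → h ≺[ n ] g
≺-respˡ f≈h (k , k<n , fk<gk , f≈g) =
  k , k<n , ≤-<-trans (≤-reflexive (sym (f≈h k<n))) fk<gk
  , λ i<k → trans (sym (f≈h (<-trans i<k k<n))) (f≈g i<k)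

≺-compare : ∀ n f g → f ≺[ n ] g ⊎ f ≈[ n ] g ⊎ g ≺[ n ] f
≺-compare zero    f g = inj₂ (inj₁ λ ())
≺-compare (suc n) f g with ≺-compare n f g
... | inj₁ (k , k<n , lt , eq) = inj₁ (k , m<n⇒m<1+n k<n , lt , eq)
... | inj₂ (inj₂ (k , k<n , lt , eq)) = inj₂ (inj₂ (k , m<n⇒m<1+n k<n , lt , eq))
... | inj₂ (inj₁ eq) with <-cmp (f n) (g n)
... | tri< lt _ _ = inj₁ (n , ≤-refl , lt , eq)
... | tri> _ _ gt = inj₂ (inj₂ (n , ≤-refl , gt , ≈-sym {f = f} eq))
... | tri≈ _ fn≡gn _ = inj₂ (inj₁ eq′)
  where
  eq′ : f ≈[ suc n ] g
  eq′ (s≤s k≤n) with m≤n⇒m<n∨m≡n k≤n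
  ... | inj₁ k<n  = eq k<n
  ... | inj₂ refl = fn≡gn

Periodic : Stream → ℕ → Set
Periodic f p = ∀ k → f (p ∔ k) ≡ f k

periodic-shift : ∀ {f p} i → Periodic f p → Periodic (shift i f) p
periodic-shift {f} {p} i per k = trans (cong f (lemma i p k)) (per (i ∔ k))
  where
  lemma : ∀ i p k → i ∔ (p ∔ k) ≡ p ∔ (i ∔ k)
  lemma = solve-∀

periodic-* : ∀ {f p} → Periodic f p → ∀ m → Periodic f (m ℕ.* p)
periodic-* per zero    k = refl
periodic-* {f} {p} per (suc m) k =
  trans (cong f (+-assoc p (m ℕ.* p) k)) (trans (per (m ℕ.* p ∔ k)) (periodic-* per m k))

periodic-ext : ∀ {f g p} → 0 <ⁿ p → Periodic f p → Periodic g p → f ≈[ p ] g → ∀ k → f k ≡ g k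
periodic-ext {f} {g} {p} 0<p perf perg eq k = begin
  f k                        ≡⟨ cong f k≡ ⟩
  f (k / p ℕ.* p ∔ k % p)    ≡⟨ periodic-* perf (k / p) (k % p) ⟩
  f (k % p)                  ≡⟨ eq (m%n<n k p) ⟩
  g (k % p)                  ≡⟨ periodic-* perg (k / p) (k % p) ⟨
  g (k / p ℕ.* p ∔ k % p)    ≡⟨ cong g k≡ ⟨
  g k                        ∎
  where
  open ≡-Reasoning
  instance _ = ℕ.>-nonZero 0<p
  k≡ : k ≡ k / p ℕ.* p ∔ k % p
  k≡ = trans (m≡m%n+[m/n]*n k p) (+-comm (k % p) _)

-- Both `f` and its shift have period `L`, so comparing them on the first `L` positions decides
-- equality everywhere.
periodic? : ∀ {f L} → 0 <ⁿ L → Periodic f L → ∀ p → Dec (Periodic f p)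
periodic? {f} {L} 0<L per p =
  map′ (λ eq → periodic-ext 0<L (periodic-shift p per) per (λ k<L → eq k<L)) (λ per′ {k} _ → per′ k)
    (allUpTo? (λ k → f (p ∔ k) ≟ f k) L)

-- Lyndon words

-- The infinite power of a Lyndon word of length `p`. Using a stream turns rotations into shifts and
-- avoids indices modulo `p`.
record LyndonPower (f : Stream) (p : ℕ) : Set where
  field
    positive : 0 <ⁿ p
    periodic : Periodic f p
    minimal  : ∀ {i} → 0 <ⁿ i → i <ⁿ p → f ≺[ p ] shift i f

open LyndonPower

-- With f = x b = b y on the period, |x| = q, minimality against the rotation b x gives y < x,
-- and against the rotation y b it gives x < y.
lyndon-unbordered : ∀ {f p q} → LyndonPower f p → 0 <ⁿ q → q <ⁿ p → ¬ (∀ {k} → q ∔ k <ⁿ p → f (q ∔ k) ≡ f k)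
lyndon-unbordered {f} {p} {q} lyn 0<q q<p border
  with k , k<p , lt , eq ← minimal lyn 0<q q<p
  with q ∔ k <? p
... | yes q+k<p = <-irrefl (sym (border q+k<p)) lt
-- The first difference lies past the border b, of length c = p - q. So k = c + m, and the letters
-- compared are those at position m of y and of x.
... | no q+k≮p
  with m , p+m≡q+k ← m≤n⇒∃[o]m+o≡n (≮⇒≥ q+k≮p)
     | c , q+c≡p ← m≤n⇒∃[o]m+o≡n (<⇒≤ q<p) =
  ≺-asym (minimal lyn 0<c c<p) (m , m<p , smaller , agrees)
  where
  wrap : ∀ m → f (q ∔ (c ∔ m)) ≡ f m
  wrap m = trans (cong f (trans (sym (+-assoc q c m)) (cong (_∔ m) q+c≡p))) (periodic lyn m)
  k≡c+m : k ≡ c ∔ m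
  k≡c+m = +-cancelˡ-≡ q k (c ∔ m)
    (trans (sym p+m≡q+k) (trans (cong (_∔ m) (sym q+c≡p)) (+-assoc q c m)))
  0<c : 0 <ⁿ c
  0<c = +-cancelˡ-< q 0 c (subst₂ _<ⁿ_ (sym (+-identityʳ q)) (sym q+c≡p) q<p)
  c<p : c <ⁿ p
  c<p = subst (c <ⁿ_) q+c≡p (m<n+m c 0<q)
  m<p : m <ⁿ p
  m<p = ≤-<-trans (m≤n+m m c) (subst (_<ⁿ p) k≡c+m k<p)
  smaller : f (c ∔ m) <ⁿ f m
  smaller = subst₂ _<ⁿ_ (cong f k≡c+m) (trans (cong (λ x → f (q ∔ x)) k≡c+m) (wrap m)) lt
  agrees : shift c f ≈[ m ] f
  agrees {i} i<m = trans (eq (subst (c ∔ i <ⁿ_) (sym k≡c+m) (+-monoʳ-< c i<m))) (wrap i)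

-- Rotating by i and then by p - i gives back `f`, so each of the two rotations would be strictly
-- below the other.
lyndon-rotation-unique : ∀ {f p i} → LyndonPower f p → 0 <ⁿ i → i <ⁿ p → ¬ LyndonPower (shift i f) p
lyndon-rotation-unique {f} {p} {i} lyn 0<i i<p lyn′
  with c , i+c≡p ← m≤n⇒∃[o]m+o≡n (<⇒≤ i<p) =
  ≺-asym (minimal lyn 0<i i<p) (≺-respʳ back (minimal lyn′ 0<c c<p))
  where
  0<c : 0 <ⁿ c
  0<c = +-cancelˡ-< i 0 c (subst₂ _<ⁿ_ (sym (+-identityʳ i)) (sym i+c≡p) i<p)
  c<p : c <ⁿ p
  c<p = subst (c <ⁿ_) i+c≡p (m<n+m c 0<i)
  back : shift c (shift i f) ≈[ p ] f
  back {k} _ = trans (cong f (trans (sym (+-assoc i c k)) (cong (_∔ k) i+c≡p))) (periodic lyn k)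

-- The common prefix covers a full period of `g`, so the smaller period of `f` would give the Lyndon
-- word of `g` a border.
lyndon-period-≤ : ∀ {f g p q n} → 0 <ⁿ p → Periodic f p → LyndonPower g q → q ≤ⁿ n → f ≈[ n ] g → ¬ p <ⁿ q
lyndon-period-≤ {f} {g} {p} 0<p per lyng q≤n eq p<q = lyndon-unbordered lyng 0<p p<q λ {k} p+k<q →
  trans (sym (eq (<-≤-trans p+k<q q≤n)))
    (trans (per k) (eq (<-≤-trans (≤-<-trans (m≤n+m k p) p+k<q) q≤n)))

lyndon-period-unique : ∀ {f g p q n} → LyndonPower f p → LyndonPower g q → p ≤ⁿ n → q ≤ⁿ n → f ≈[ n ] g → p ≡ q
lyndon-period-unique {f} {p = p} {q} lynf lyng p≤n q≤n eq with <-cmp p q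
... | tri< p<q _ _ = contradiction p<q (lyndon-period-≤ (positive lynf) (periodic lynf) lyng q≤n eq)
... | tri≈ _ p≡q _ = p≡q
... | tri> _ _ q<p = contradiction q<p (lyndon-period-≤ (positive lyng) (periodic lyng) lynf p≤n (≈-sym {f = f} eq))

-- Primitive periods and Lyndon rotations

Primitive : Stream → ℕ → Set
Primitive f p = ∀ {q} → 0 <ⁿ q → q <ⁿ p → ¬ Periodic f q

primitive-period : ∀ {f} L → 0 <ⁿ L → Periodic f L → ∃ λ p → 0 <ⁿ p × Periodic f p × Primitive f p
primitive-period {f} = <-rec _ step
  where
  step : ∀ L → (∀ {q} → q <ⁿ L → 0 <ⁿ q → Periodic f q → ∃ λ p → 0 <ⁿ p × Periodic f p × Primitive f p) →
         0 <ⁿ L → Periodic f L → ∃ λ p → 0 <ⁿ p × Periodic f p × Primitive f p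
  step L rec 0<L per with anyUpTo? (λ q → (0 <? q) ×-dec periodic? 0<L per q) L
  ... | yes (q , q<L , 0<q , perq) = rec q<L 0<q perq
  ... | no none = L , 0<L , per , λ 0<q q<L perq → none (_ , q<L , 0<q , perq)

-- The remainder of L modulo p is again a period, so by primitivity it is zero.
primitive-divides : ∀ {f p L} → 0 <ⁿ p → Periodic f p → Primitive f p → Periodic f L → ∃ λ m → L ≡ m ℕ.* p
primitive-divides {f} {p} {L} 0<p per prim perL = L / p , L≡
  where
  instance _ = ℕ.>-nonZero 0<p
  perr : Periodic f (L % p)
  perr k = begin
    f (L % p ∔ k)                      ≡⟨ periodic-* per (L / p) (L % p ∔ k) ⟨
    f (L / p ℕ.* p ∔ (L % p ∔ k))      ≡⟨ cong f (lemma (L / p ℕ.* p) (L % p) k) ⟩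
    f (L % p ∔ L / p ℕ.* p ∔ k)        ≡⟨ cong (λ m → f (m ∔ k)) (m≡m%n+[m/n]*n L p) ⟨
    f (L ∔ k)                          ≡⟨ perL k ⟩
    f k                                ∎
    where
    open ≡-Reasoning
    lemma : ∀ a b k → a ∔ (b ∔ k) ≡ b ∔ a ∔ k
    lemma = solve-∀
  L≡ : L ≡ L / p ℕ.* p
  L≡ with L % p in r≡ | m≡m%n+[m/n]*n L p
  ... | zero  | eq = eq
  ... | suc r | _  = contradiction (subst (Periodic f) r≡ perr)
                       (prim (s≤s z≤n) (subst (_<ⁿ p) r≡ (m%n<n L p)))

primitive-rotations-distinct : ∀ {f p i j} → 0 <ⁿ p → Periodic f p → Primitive f p →
  i <ⁿ j → j <ⁿ p → ¬ shift i f ≈[ p ] shift j f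
primitive-rotations-distinct {f} {p} {i} {j} 0<p per prim i<j j<p eq
  with d , i+d≡j ← m≤n⇒∃[o]m+o≡n (<⇒≤ i<j)
     | c , i+c≡p ← m≤n⇒∃[o]m+o≡n (<⇒≤ (<-trans i<j j<p)) =
  prim 0<d (≤-<-trans (subst (d ≤ⁿ_) i+d≡j (m≤n+m d i)) j<p) perd
  where
  0<d : 0 <ⁿ d
  0<d = +-cancelˡ-< i 0 d (subst₂ _<ⁿ_ (sym (+-identityʳ i)) (sym i+d≡j) i<j)
  all : ∀ k → f (i ∔ k) ≡ f (j ∔ k)
  all = periodic-ext 0<p (periodic-shift i per) (periodic-shift j per) eq
  perd : Periodic f d
  perd k = begin
    f (d ∔ k)            ≡⟨ per (d ∔ k) ⟨
    -- A full period is inserted and split as i + c, which exposes the offset i that can be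
    -- exchanged for j.
    f (p ∔ (d ∔ k))      ≡⟨ cong (λ x → f (x ∔ (d ∔ k))) i+c≡p ⟨
    f (i ∔ c ∔ (d ∔ k))  ≡⟨ cong f (lemma i c d k) ⟩
    f (i ∔ d ∔ (c ∔ k))  ≡⟨ cong (λ x → f (x ∔ (c ∔ k))) i+d≡j ⟩
    f (j ∔ (c ∔ k))      ≡⟨ all (c ∔ k) ⟨
    f (i ∔ (c ∔ k))      ≡⟨ cong f (+-assoc i c k) ⟨
    f (i ∔ c ∔ k)        ≡⟨ cong (λ x → f (x ∔ k)) i+c≡p ⟩
    f (p ∔ k)            ≡⟨ per k ⟩
    f k                  ∎
    where
    open ≡-Reasoning
    lemma : ∀ i c d k → i ∔ c ∔ (d ∔ k) ≡ i ∔ d ∔ (c ∔ k)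
    lemma = solve-∀

-- A running minimum over the rotations 0 to m; it is strict because a primitive word has distinct
-- rotations.
least-rotation : ∀ {f p} → 0 <ⁿ p → Periodic f p → Primitive f p → ∀ m → m <ⁿ p →
  ∃ λ i → i ≤ⁿ m × (∀ {j} → j ≤ⁿ m → ¬ j ≡ i → shift i f ≺[ p ] shift j f)
least-rotation 0<p per prim zero m<p = 0 , z≤n , λ where z≤n j≢i → contradiction refl j≢i
least-rotation {f} {p} 0<p per prim (suc m) m<p
  with i , i≤m , least ← least-rotation 0<p per prim m (<⇒≤ m<p)
  with ≺-compare p (shift i f) (shift (suc m) f)
... | inj₁ lt = i , m≤n⇒m≤1+n i≤m , least′
  where
  least′ : ∀ {j} → j ≤ⁿ suc m → ¬ j ≡ i → shift i f ≺[ p ] shift j f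
  least′ j≤ j≢i with m≤n⇒m<n∨m≡n j≤
  ... | inj₁ (s≤s j≤m) = least j≤m j≢i
  ... | inj₂ refl      = lt
... | inj₂ (inj₁ eq) = contradiction (λ {k} → eq {k}) (primitive-rotations-distinct 0<p per prim (s≤s i≤m) m<p)
... | inj₂ (inj₂ gt) = suc m , ≤-refl , least′
  where
  least′ : ∀ {j} → j ≤ⁿ suc m → ¬ j ≡ suc m → shift (suc m) f ≺[ p ] shift j f
  least′ {j} j≤ j≢ with m≤n⇒m<n∨m≡n j≤ | j ≟ i
  ... | inj₂ refl      | _        = contradiction refl j≢
  ... | inj₁ _         | yes refl = gt
  ... | inj₁ (s≤s j≤m) | no j≢i   = ≺-trans {f = shift (suc m) f} {g = shift i f} gt (least j≤m j≢i)

lyndon-rotation : ∀ {f p} → 0 <ⁿ p → Periodic f p → Primitive f p → ∃ λ i → i <ⁿ p × LyndonPower (shift i f) p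
lyndon-rotation {f} {suc q} 0<p per prim with i , i≤q , least ← least-rotation 0<p per prim q ≤-refl =
  i , s≤s i≤q , record { positive = 0<p ; periodic = periodic-shift i per ; minimal = min }
  where
  p = suc q
  min : ∀ {j} → 0 <ⁿ j → j <ⁿ p → shift i f ≺[ p ] shift j (shift i f)
  min {j} 0<j j<p with i ∔ j <? p
  ... | yes (s≤s i+j≤q) = ≺-respʳ (λ {k} _ → cong f (+-assoc i j k))
          (least i+j≤q (λ eq → <-irrefl (sym eq) (m<m+n i 0<j)))
  -- The combined rotation passes the end of the period and equals the rotation by m = i + j - p,
  -- which is below i and hence different from it.
  ... | no i+j≮p with m , p+m≡i+j ← m≤n⇒∃[o]m+o≡n (≮⇒≥ i+j≮p) =
    ≺-respʳ (λ {k} _ → trans (sym (per (m ∔ k)))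
        (cong f (trans (sym (+-assoc p m k)) (trans (cong (_∔ k) p+m≡i+j) (+-assoc i j k)))))
      (least (≤-trans (<⇒≤ m<i) i≤q) (<⇒≢ m<i))
    where
    m<i : m <ⁿ i
    m<i = +-cancelʳ-< p m i (subst (_<ⁿ i ∔ p) (trans (sym p+m≡i+j) (+-comm p m)) (+-monoʳ-< i j<p))

lyndon-root : ∀ {f L} → 0 <ⁿ L → Periodic f L →
  ∃₂ λ g p → LyndonPower g p × (∃ λ m → L ≡ suc m ℕ.* p) × (∃ λ j → j <ⁿ p × (∀ k → f k ≡ g (j ∔ k)))
lyndon-root {f} {L} 0<L perL
  with p , 0<p , per , prim ← primitive-period L 0<L perL
  with i , i<p , lyn ← lyndon-rotation 0<p per prim =
  shift i f , p , lyn , multiple (primitive-divides 0<p per prim perL) , unrotate i i<p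
  where
  multiple : (∃ λ m → L ≡ m ℕ.* p) → ∃ λ m → L ≡ suc m ℕ.* p
  multiple (zero  , L≡) = contradiction (subst (0 <ⁿ_) L≡ 0<L) (λ ())
  multiple (suc m , L≡) = m , L≡
  unrotate : ∀ i → i <ⁿ p → ∃ λ j → j <ⁿ p × (∀ k → f k ≡ f (i ∔ (j ∔ k)))
  -- Rotation 0 is separate, since its complement p - 0 is not below p.
  unrotate zero    _   = 0 , 0<p , λ _ → refl
  unrotate (suc i) i<p with c , i+c≡p ← m≤n⇒∃[o]m+o≡n (<⇒≤ i<p) =
    c , subst (c <ⁿ_) i+c≡p (s≤s (m≤n+m c i))
    , λ k → trans (sym (per k)) (cong f (trans (cong (_∔ k) (sym i+c≡p)) (+-assoc (suc i) c k)))

lyndon-cong : ∀ {f g p} → (∀ k → f k ≡ g k) → LyndonPower f p → LyndonPower g p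
lyndon-cong {f} {g} {p} eq lyn = record
  { positive = positive lyn
  ; periodic = λ k → trans (sym (eq (p ∔ k))) (trans (periodic lyn k) (eq k))
  ; minimal  = λ {i} 0<i i<p → ≺-respʳ {g = shift i f} (λ {k} _ → eq (i ∔ k))
                 (≺-respˡ {f = f} (λ {k} _ → eq k) (minimal lyn 0<i i<p))
  }

-- Counting below a bound

module _ {P : ℕ → Set} (P? : ∀ k → Dec (P k)) where

  count : ℕ → ℕ
  count zero    = 0
  count (suc a) = if does (P? a) then suc (count a) else count a

  count-suc-≤ : ∀ a → count (suc a) ≤ⁿ suc (count a)
  count-suc-≤ a with P? a
  ... | yes _ = ≤-refl
  ... | no _  = n≤1+n _

  count-suc-≥ : ∀ a → count a ≤ⁿ count (suc a)
  count-suc-≥ a with P? a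
  ... | yes _ = n≤1+n _
  ... | no _  = ≤-refl

  count-+-≤ : ∀ b a → count (b ∔ a) ≤ⁿ b ∔ count a
  count-+-≤ zero    a = ≤-refl
  count-+-≤ (suc b) a = ≤-trans (count-suc-≤ (b ∔ a)) (s≤s (count-+-≤ b a))

  count-+-≥ : ∀ b a → count a ≤ⁿ count (b ∔ a)
  count-+-≥ zero    a = ≤-refl
  count-+-≥ (suc b) a = ≤-trans (count-+-≥ b a) (count-suc-≥ (b ∔ a))

  count-≤ : ∀ a → count a ≤ⁿ a
  count-≤ zero    = z≤n
  count-≤ (suc a) = ≤-trans (count-suc-≤ a) (s≤s (count-≤ a))

  count-none : ∀ b {a} → (∀ {d} → d <ⁿ b → ¬ P (d ∔ a)) → count (b ∔ a) ≡ count a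
  count-none zero    none = refl
  count-none (suc b) {a} none with P? (b ∔ a)
  ... | yes Pb = contradiction Pb (none ≤-refl)
  ... | no _   = count-none b (none ∘ m<n⇒m<1+n)

  count-< : ∀ {i j} → P i → i <ⁿ j → count i <ⁿ count j
  count-< {i} Pi i<j with d , refl ← m≤n⇒∃[o]m+o≡n i<j =
    <-≤-trans here-< (subst (λ k → count (suc i) ≤ⁿ count k) (+-comm d (suc i)) (count-+-≥ d (suc i)))
    where
    here-< : count i <ⁿ count (suc i)
    here-< with P? i
    ... | yes _  = ≤-refl
    ... | no ¬Pi = contradiction Pi ¬Pi

  count-injective : ∀ {i j} → P i → P j → count i ≡ count j → i ≡ j
  count-injective {i} {j} Pi Pj eq with <-cmp i j
  ... | tri< i<j _ _ = contradiction eq (<⇒≢ (count-< Pi i<j))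
  ... | tri≈ _ i≡j _ = i≡j
  ... | tri> _ _ j<i = contradiction (sym eq) (<⇒≢ (count-< Pj j<i))

  count-period : ∀ {p} → (∀ {k} → P (k ∔ p) → P k) → (∀ {k} → P k → P (k ∔ p)) →
    ∀ a → count (a ∔ p) ≡ count a ∔ count p
  count-period      down up zero    = refl
  count-period {p} down up (suc a) with P? (a ∔ p) | P? a
  ... | yes _  | yes _  = cong suc (count-period down up a)
  ... | no _   | no _   = count-period down up a
  ... | yes Pₚ | no ¬P  = contradiction (down Pₚ) ¬P
  ... | no ¬Pₚ | yes Pa = contradiction (up Pa) ¬Pₚ

  -- A period contains more than count j solutions, hence fewer than p ∸ count j gaps.
  window : ∀ {p j} → (∀ {k} → P (k ∔ p) → P k) → (∀ {k} → P k → P (k ∔ p)) →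
    P j → j <ⁿ p → ∀ s → ∃ λ d → d ∔ count j <ⁿ p × P (d ∔ s)
  window {p} {j} down up Pj j<p s
    with e , r+e≡p ← m≤n⇒∃[o]m+o≡n (≤-trans (count-≤ j) (<⇒≤ j<p))
    with anyUpTo? (λ d → P? (d ∔ s)) e
  ... | yes (d , d<e , Pd) =
    d , subst (d ∔ count j <ⁿ_) (trans (+-comm e (count j)) r+e≡p) (+-monoˡ-< (count j) d<e) , Pd
  -- Otherwise the period starting at s begins with e = p - count j gaps and has at most count j
  -- solutions, while `P j` forces more.
  ... | no none = contradiction too-few (<⇒≱ (+-monoʳ-< (count s) (count-< Pj j<p)))
    where
    open ≤-Reasoning
    too-few : count s ∔ count p ≤ⁿ count s ∔ count j
    too-few = begin
      count s ∔ count p          ≡⟨ count-period down up s ⟨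
      count (s ∔ p)              ≡⟨ cong count (trans (+-comm s p) (trans (cong (_∔ s) (sym r+e≡p))
                                      (+-assoc (count j) e s))) ⟩
      count (count j ∔ (e ∔ s))  ≤⟨ count-+-≤ (count j) (e ∔ s) ⟩
      count j ∔ count (e ∔ s)    ≡⟨ cong (count j ∔_) (count-none e λ d<e Pd → none (_ , d<e , Pd)) ⟩
      count j ∔ count s          ≡⟨ +-comm (count j) (count s) ⟩
      count s ∔ count j          ∎

count-cong : ∀ {P Q : ℕ → Set} (P? : ∀ k → Dec (P k)) (Q? : ∀ k → Dec (Q k)) →
  (∀ {k} → P k → Q k) → (∀ {k} → Q k → P k) → ∀ a → count P? a ≡ count Q? a
count-cong P? Q? P⇒Q Q⇒P zero    = refl
count-cong P? Q? P⇒Q Q⇒P (suc a) with P? a | Q? a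
... | yes _ | yes _  = cong suc (count-cong P? Q? P⇒Q Q⇒P a)
... | no _  | no _   = count-cong P? Q? P⇒Q Q⇒P a
... | yes Pa | no ¬Q = contradiction (P⇒Q Pa) ¬Q
... | no ¬P | yes Qa = contradiction (Q⇒P Qa) ¬P

-- Rauzy graphs

module _ (W : Stream) (N : ℕ) where

  -- A word of length `n` is given by any stream having it as a prefix. The bound `N` keeps its
  -- occurrence inside the word that `W` extends.
  Occurs : Stream → ℕ → Set
  Occurs f n = ∃ λ i → i ∔ n ≤ⁿ N × shift i W ≈[ n ] f

  occurs-cong : ∀ {f g n} → f ≈[ n ] g → Occurs f n → Occurs g n
  occurs-cong f≈g (i , i+n≤N , W≈f) = i , i+n≤N , λ k<n → trans (W≈f k<n) (f≈g k<n)

  occurs-shift : ∀ {f m} e {n} → e ∔ n ≤ⁿ m → Occurs f m → Occurs (shift e f) n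
  occurs-shift e {n} e+n≤m (i , i+m≤N , W≈f) =
    i ∔ e , ≤-trans (≤-reflexive (+-assoc i e n)) (≤-trans (+-monoʳ-≤ i e+n≤m) i+m≤N)
    , λ {k} k<n → trans (cong W (+-assoc i e k)) (W≈f (<-≤-trans (+-monoʳ-< e k<n) e+n≤m))

  occurs? : ∀ f n → Dec (Occurs f n)
  occurs? f n = map′ (λ (i , _ , i+n≤N , eq) → i , i+n≤N , λ k<n → eq k<n)
    (λ (i , i+n≤N , eq) → i , s≤s (≤-trans (m≤m+n i n) i+n≤N) , i+n≤N , λ {k} → eq {k})
    (anyUpTo? (λ i → (i ∔ n ≤? N) ×-dec allUpTo? (λ k → W (i ∔ k) ≟ f k) n) (suc N))

  occurrences : ℕ → List (List ℕ)
  occurrences n = applyUpTo (λ i → applyUpTo (shift i W) n) (suc N ∸ n)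

  words : ℕ → List (List ℕ)
  words n = deduplicate (≡-dec _≟_) (occurrences n)

  words-length : ∀ n → length (words n) ≤ⁿ suc N ∸ n
  words-length n = ≤-trans (length-deduplicate (≡-dec _≟_) (occurrences n))
    (≤-reflexive (length-applyUpTo _ (suc N ∸ n)))

  words-unique : ∀ n → Unique (words n)
  words-unique n = UniqueDec.deduplicate-! (≡-dec _≟_) _

  ∈-words⁺ : ∀ {f n} → Occurs f n → applyUpTo f n ∈ words n
  ∈-words⁺ {f} {n} (i , i+n≤N , eq) = subst (_∈ words n) (applyUpTo-cong n eq)
    (∈-deduplicate⁺ (≡-dec _≟_) (∈-applyUpTo⁺ _ (m+n≤o⇒m≤o∸n (suc i) (s≤s i+n≤N))))

  ∈-words⁻ : ∀ {n z} → z ∈ words n → ∃ λ i → i ∔ n ≤ⁿ N × z ≡ applyUpTo (shift i W) n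
  ∈-words⁻ {n} z∈ with i , i< , z≡ ← ∈-applyUpTo⁻ _ (∈-deduplicate⁻ (≡-dec _≟_) _ z∈) =
    i , ≤-pred (m≤o∸n⇒m+n≤o (suc i) (<⇒≤ (m∸n≢0⇒n<m (m<n⇒n≢0 i<))) i<) , z≡

  -- The edge starting with the Lyndon rotation, on a circuit of length p of the Rauzy graph of order n.
  Special : ℕ → List ℕ → Set
  Special n z = ∃₂ λ g p → LyndonPower g p × p ≤ⁿ n ×
    (∀ i → Occurs (shift i g) (suc n)) × z ≡ applyUpTo g (suc n)

  special-length : ∀ {n z} → Special n z → suc n ≤ⁿ N
  special-length {n} (_ , _ , _ , _ , occ , _) with i , i+≤ , _ ← occ 0 = ≤-trans (m≤n+m (suc n) i) i+≤

  module _ (n : ℕ) (colour : List ℕ → List ℕ) where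

    private
      C : Stream → List ℕ
      C f = colour (applyUpTo f n)

      C-cong : ∀ {f g} → f ≈[ n ] g → C f ≡ C g
      C-cong eq = cong colour (applyUpTo-cong n eq)

    -- The hypothesis asks `colour` to agree only across edges that are not special. Deriving that
    -- it is constant says that the graph without its special edges is connected.
    module _ (edge : ∀ f → Occurs f (suc n) → Special n (applyUpTo f (suc n)) ⊎ C f ≡ C (f ∘ suc)) where

      -- The other edges of the circuit are either not special or special with a smaller period.
      special-edge : ∀ p f → LyndonPower f p → p ≤ⁿ n → (∀ i → Occurs (shift i f) (suc n)) → C f ≡ C (f ∘ suc)
      special-edge = <-rec _ step
        where
        step : ∀ p →
          (∀ {q} → q <ⁿ p → ∀ f → LyndonPower f q → q ≤ⁿ n → (∀ i → Occurs (shift i f) (suc n)) → C f ≡ C (f ∘ suc)) →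
          ∀ f → LyndonPower f p → p ≤ⁿ n → (∀ i → Occurs (shift i f) (suc n)) → C f ≡ C (f ∘ suc)
        -- From the end of the special edge, the other p - 1 edges of the circuit lead back to its
        -- start.
        step p rec f lyn p≤n occ = sym (trans (around p (positive lyn) ≤-refl) (C-cong λ _ → periodic lyn _))
          where
          next : ∀ i → 0 <ⁿ i → i <ⁿ p → C (shift i f) ≡ C (shift i f ∘ suc)
          next i 0<i i<p with edge (shift i f) (occ i)
          ... | inj₂ eq = eq
          ... | inj₁ (g , q , lyng , q≤n , occg , z≡) with applyUpTo-injective (suc n) z≡ | <-cmp p q
          -- The streams agree on more letters than either period. Here p < q would give a Lyndon
          -- word a border, and p = q would give one circuit two Lyndon rotations; q < p is left to
          -- the induction.
          ... | eq | tri< p<q _ _ = contradiction p<q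
            (lyndon-period-≤ (positive lyn) (periodic-shift i (periodic lyn)) lyng (m≤n⇒m≤1+n q≤n) eq)
          ... | eq | tri≈ _ refl _ = contradiction
            (lyndon-cong (λ k → sym (periodic-ext (positive lyn) (periodic-shift i (periodic lyn)) (periodic lyng)
              (λ k<p → eq (<-≤-trans k<p (m≤n⇒m≤1+n p≤n))) k)) lyng)
            (lyndon-rotation-unique lyn 0<i i<p)
          ... | eq | tri> _ _ q<p =
            trans (C-cong (eq ∘ m<n⇒m<1+n)) (trans (rec q<p g lyng q≤n occg) (sym (C-cong (eq ∘ s≤s))))

          around : ∀ i → 0 <ⁿ i → i ≤ⁿ p → C (f ∘ suc) ≡ C (shift i f)
          around (suc zero)    _ _   = refl
          around (suc (suc i)) _ i<p = trans (around (suc i) (s≤s z≤n) (<⇒≤ i<p))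
            (trans (next (suc i) (s≤s z≤n) i<p) (C-cong λ {k} _ → cong (f ∘ suc) (+-suc i k)))

      every-edge : ∀ f → Occurs f (suc n) → C f ≡ C (f ∘ suc)
      every-edge f occ with edge f occ
      ... | inj₂ eq = eq
      ... | inj₁ (g , p , lyn , p≤n , occg , z≡) with eq ← applyUpTo-injective (suc n) z≡ =
        trans (C-cong (eq ∘ m<n⇒m<1+n)) (trans (special-edge p g lyn p≤n occg) (sym (C-cong (eq ∘ s≤s))))

      -- The word itself is a walk through all vertices: consecutive windows are joined by an edge.
      constant : ∀ i → i ∔ n ≤ⁿ N → C (shift i W) ≡ C W
      constant zero    _  = refl
      constant (suc i) i≤ = trans
        (C-cong λ {k} _ → cong W (sym (+-suc i k)))
        (trans (sym (every-edge (shift i W) (i , subst (_≤ⁿ N) (sym (+-suc i n)) i≤ , λ _ → refl)))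
               (constant i (<⇒≤ i≤)))

  -- The edges that are not special connect all vertices, so they number at least C(n) - 1; the
  -- special ones are the rest of the C(n+1) edges.
  level : ∀ n → ¬ ¬ (∃ λ zs → length zs ∔ length (words n) ≤ⁿ suc (length (words (suc n))) ×
    (∀ {z} → Special n z → z ∈ zs))
  level n k = ¬¬-split (Special n) (words (suc n)) λ (ys , es , len , special⇒ , dich) →
    k (ys , bound ys es len dich , λ sp → special⇒ (special-word sp) sp)
    where
    special-word : ∀ {z} → Special n z → z ∈ words (suc n)
    special-word (_ , _ , _ , _ , occ , refl) = ∈-words⁺ (occ 0)

    -- An edge of n + 1 letters goes from its prefix to its suffix of length n.
    ends : List ℕ → List ℕ × List ℕ
    ends z = take n z , drop 1 z

    bound : ∀ ys es → length ys ∔ length es ≡ length (words (suc n)) →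
      (∀ {z} → z ∈ words (suc n) → Special n z ⊎ z ∈ es) →
      length ys ∔ length (words n) ≤ⁿ suc (length (words (suc n)))
    bound ys es len dich = begin
      length ys ∔ length (words n)     ≤⟨ +-monoʳ-≤ (length ys) (connected⇒length-≤ (≡-dec _≟_) (map ends es)
                                            (length-map ends es) (words-unique n) connected) ⟩
      length ys ∔ suc (length es)      ≡⟨ +-suc (length ys) _ ⟩
      suc (length ys ∔ length es)      ≡⟨ cong suc len ⟩
      suc (length (words (suc n)))     ∎
      where
      open ≤-Reasoning
      connected : ∀ g → (∀ {a b} → (a , b) ∈ map ends es → g a ≡ g b) →
        ∀ {x y} → x ∈ words n → y ∈ words n → g x ≡ g y
      connected g agree x∈ y∈
        with i , i≤ , refl ← ∈-words⁻ x∈ | j , j≤ , refl ← ∈-words⁻ y∈ =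
        trans (constant n g edge i i≤) (sym (constant n g edge j j≤))
        where
        edge : ∀ f → Occurs f (suc n) →
          Special n (applyUpTo f (suc n)) ⊎ g (applyUpTo f n) ≡ g (applyUpTo (f ∘ suc) n)
        edge f occ with dich (∈-words⁺ occ)
        ... | inj₁ sp = inj₁ sp
        ... | inj₂ z∈ = inj₂ (trans (cong g (sym (take-applyUpTo n f))) (agree (∈-map⁺ ends z∈)))

  -- The bounds of `level` telescope. Order 0 has no special edge, a Lyndon period being positive,
  -- so the sum starts at `words 1`, which will account for the letters.
  levels : ∀ k → ¬ ¬ (∃ λ zs → length zs ∔ length (words 1) ≤ⁿ length (words (suc k)) ∔ k ×
    (∀ {n z} → n ≤ⁿ k → Special n z → z ∈ zs))
  levels zero c = c ([] , m≤m+n _ 0 , λ where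
    z≤n (_ , _ , lyn , z≤n , _) → contradiction (positive lyn) (λ ()))
  levels (suc k) c = levels k λ (zs , zs≤ , zs∋) → level (suc k) λ (ys , ys≤ , ys∋) →
    c (ys ++ zs , bound ys zs zs≤ ys≤ , λ n≤ sp → member ys zs∋ ys∋ n≤ sp)
    where
    member : ∀ ys {zs} → (∀ {n z} → n ≤ⁿ k → Special n z → z ∈ zs) → (∀ {z} → Special (suc k) z → z ∈ ys) →
      ∀ {n z} → n ≤ⁿ suc k → Special n z → z ∈ ys ++ zs
    member ys zs∋ ys∋ n≤ sp with m≤n⇒m<n∨m≡n n≤
    ... | inj₁ (s≤s n≤k) = ∈-++⁺ʳ ys (zs∋ n≤k sp)
    ... | inj₂ refl      = ∈-++⁺ˡ (ys∋ sp)

    bound : ∀ ys zs → length zs ∔ length (words 1) ≤ⁿ length (words (suc k)) ∔ k →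
      length ys ∔ length (words (suc k)) ≤ⁿ suc (length (words (suc (suc k)))) →
      length (ys ++ zs) ∔ length (words 1) ≤ⁿ length (words (suc (suc k))) ∔ suc k
    bound ys zs zs≤ ys≤ = begin
      length (ys ++ zs) ∔ length (words 1)             ≡⟨ cong (_∔ length (words 1)) (length-++ ys) ⟩
      length ys ∔ length zs ∔ length (words 1)         ≡⟨ +-assoc (length ys) _ _ ⟩
      length ys ∔ (length zs ∔ length (words 1))       ≤⟨ +-monoʳ-≤ (length ys) zs≤ ⟩
      length ys ∔ (length (words (suc k)) ∔ k)         ≡⟨ +-assoc (length ys) _ k ⟨
      length ys ∔ length (words (suc k)) ∔ k           ≤⟨ +-monoˡ-≤ k ys≤ ⟩
      suc (length (words (suc (suc k))) ∔ k)           ≡⟨ +-suc _ k ⟨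
      length (words (suc (suc k))) ∔ suc k             ∎
      where open ≤-Reasoning

  -- Squares as codes of special edges

  windows : Stream → ℕ → ℕ → ℕ
  windows g m = count (λ b → occurs? (shift b g) m)

  -- The rank of window `j` among the occurring ones is at most `j`, hence below `p`. So rank and
  -- `q` are the remainder and quotient of this number by `p`.
  code-length : Stream → ℕ → ℕ → ℕ → ℕ
  code-length g p q j = windows g (suc q ℕ.* p) j ∔ q ℕ.* p

  -- `suc q` is the exponent of the power `u` of a Lyndon rotation; it is at least 2, which makes
  -- the order of the circuit at least `p`.
  Code : List ℕ → List ℕ → Set
  Code u z = ∃₂ λ g p → ∃₂ λ q j → LyndonPower g p × 0 <ⁿ q × j <ⁿ p ×
    Occurs (shift j g) (suc q ℕ.* p) ×
    u ≡ applyUpTo (shift j g) (suc q ℕ.* p) ×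
    z ≡ applyUpTo g (suc (code-length g p q j))

  period-≤-code-length : ∀ g {p q} j → 0 <ⁿ q → p ≤ⁿ code-length g p q j
  period-≤-code-length g {p} {suc q} j _ =
    ≤-trans (m≤m+n p (q ℕ.* p)) (m≤n+m _ (windows g (suc (suc q) ℕ.* p) j))

  code-special : ∀ {u z} → Code u z → ∃ λ n → Special n z
  code-special (g , p , q , j , lyn , 0<q , j<p , occ , _ , z≡) =
    code-length g p q j , g , p , lyn , period-≤-code-length g j 0<q , all , z≡
    where
    m = suc q ℕ.* p
    r = windows g m j
    move : ∀ b k → g (b ∔ k) ≡ g (b ∔ p ∔ k)
    move b k = trans (sym (periodic lyn (b ∔ k))) (cong g (lemma p b k))
      where
      lemma : ∀ p b k → p ∔ (b ∔ k) ≡ b ∔ p ∔ k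
      lemma = solve-∀
    all : ∀ t → Occurs (shift t g) (suc (r ∔ q ℕ.* p))
    -- Searching from t + r + 1 gives a window whose start, moved on by e = p - (d + r + 1), is t +
    -- p, that is t modulo the period. At least r + 1 + q p of its letters remain.
    all t with window (λ b → occurs? (shift b g) m) (λ {b} → occurs-cong λ {k} _ → sym (move b k))
                 (λ {b} → occurs-cong λ {k} _ → move b k) occ j<p (t ∔ suc r)
    ... | d , d+r<p , occd with e , eq ← m≤n⇒∃[o]m+o≡n d+r<p =
      occurs-cong (λ {k} _ → trans (cong g (trans (lemma₂ d t r e k) (cong (λ x → t ∔ x ∔ k) eq))) (sym (move t k)))
        (occurs-shift e fits occd)
      where
      lemma₁ : ∀ e r x → e ∔ suc (r ∔ x) ≡ suc (r ∔ e) ∔ x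
      lemma₁ = solve-∀
      lemma₂ : ∀ d t r e k → d ∔ (t ∔ suc r) ∔ (e ∔ k) ≡ t ∔ (suc (d ∔ r) ∔ e) ∔ k
      lemma₂ = solve-∀
      fits : e ∔ suc (r ∔ q ℕ.* p) ≤ⁿ m
      fits = begin
        e ∔ suc (r ∔ q ℕ.* p)        ≡⟨ lemma₁ e r (q ℕ.* p) ⟩
        suc (r ∔ e) ∔ q ℕ.* p        ≤⟨ +-monoˡ-≤ (q ℕ.* p) (s≤s (+-monoˡ-≤ e (m≤n+m r d))) ⟩
        suc (d ∔ r ∔ e) ∔ q ℕ.* p    ≡⟨ cong (_∔ q ℕ.* p) eq ⟩
        p ∔ q ℕ.* p                  ∎
        where open ≤-Reasoning

  -- Division by p recovers the rank and the exponent from the length; the rank then determines j,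
  -- since both windows occur.
  same-period⇒same-window : ∀ {g g′ p q q′ j j′} → LyndonPower g p → LyndonPower g′ p → 0 <ⁿ q → j <ⁿ p → j′ <ⁿ p →
    Occurs (shift j g) (suc q ℕ.* p) → Occurs (shift j′ g′) (suc q′ ℕ.* p) →
    code-length g p q j ≡ code-length g′ p q′ j′ → g ≈[ suc (code-length g p q j) ] g′ →
    applyUpTo (shift j g) (suc q ℕ.* p) ≡ applyUpTo (shift j′ g′) (suc q′ ℕ.* p)
  same-period⇒same-window {g} {g′} {p} {q} {q′} {j} {j′} lyn lyn′ 0<q j<p j′<p occ occ′ len eq =
    finish (sym q≡q′) occ′ r≡r′
    where
    instance _ = ℕ.>-nonZero (positive lyn)
    g≗g′ : ∀ k → g k ≡ g′ k
    g≗g′ = periodic-ext (positive lyn) (periodic lyn) (periodic lyn′)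
      λ k<p → eq (<-≤-trans k<p (m≤n⇒m≤1+n (period-≤-code-length g j 0<q)))
    r  = windows g (suc q ℕ.* p) j
    r′ = windows g′ (suc q′ ℕ.* p) j′
    remainder : ∀ {x i} q → x ≤ⁿ i → i <ⁿ p → (x ∔ q ℕ.* p) % p ≡ x
    remainder {x} q x≤i i<p = trans ([m+kn]%n≡m%n x q p) (m<n⇒m%n≡m (≤-<-trans x≤i i<p))
    r≡r′ : r ≡ r′
    r≡r′ = trans (sym (remainder q (count-≤ _ j) j<p))
      (trans (cong (_% p) len) (remainder q′ (count-≤ _ j′) j′<p))
    q≡q′ : q ≡ q′
    q≡q′ = *-cancelʳ-≡ q q′ p (+-cancelˡ-≡ r _ _ (trans len (cong (_∔ q′ ℕ.* p) (sym r≡r′))))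
    finish : ∀ {q′} → q′ ≡ q → Occurs (shift j′ g′) (suc q′ ℕ.* p) → r ≡ windows g′ (suc q′ ℕ.* p) j′ →
      applyUpTo (shift j g) (suc q ℕ.* p) ≡ applyUpTo (shift j′ g′) (suc q′ ℕ.* p)
    finish refl occ′ r≡r′ = applyUpTo-cong (suc q ℕ.* p)
      (λ {k} _ → trans (g≗g′ (j ∔ k)) (cong (λ i → g′ (i ∔ k)) j≡j′))
      where
      m = suc q ℕ.* p
      j≡j′ : j ≡ j′
      j≡j′ = count-injective (λ b → occurs? (shift b g′) m) (occurs-cong (λ _ → g≗g′ _) occ) occ′
        (trans (count-cong (λ b → occurs? (shift b g′) m) (λ b → occurs? (shift b g) m)
                 (occurs-cong λ _ → sym (g≗g′ _)) (occurs-cong λ _ → g≗g′ _) j) r≡r′)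

  -- The edge `z` is longer than both periods, and a prefix covering a Lyndon word determines its
  -- period. This reduces to the case of equal periods.
  code-injective : ∀ {u u′ z} → Code u z → Code u′ z → u ≡ u′
  code-injective (g , p , q , j , lyn , 0<q , j<p , occ , refl , refl)
                 (g′ , p′ , q′ , j′ , lyn′ , 0<q′ , j′<p′ , occ′ , refl , z≡) =
    align p≡p′ lyn′ j′<p′ occ′ lengths
    where
    n = code-length g p q j
    lengths : n ≡ code-length g′ p′ q′ j′
    lengths = suc-injective (trans (sym (length-applyUpTo g _)) (trans (cong length z≡) (length-applyUpTo g′ _)))
    g≈g′ : g ≈[ suc n ] g′
    g≈g′ = applyUpTo-injective (suc n) {g} {g′} (trans z≡ (cong (applyUpTo g′ ∘ suc) (sym lengths)))
    p≡p′ : p ≡ p′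
    p≡p′ = lyndon-period-unique {f = g} {g = g′} lyn lyn′ (m≤n⇒m≤1+n (period-≤-code-length g j 0<q))
      (m≤n⇒m≤1+n (subst (p′ ≤ⁿ_) (sym lengths) (period-≤-code-length g′ j′ 0<q′))) (λ {k} → g≈g′ {k})
    align : ∀ {p′} → p ≡ p′ → LyndonPower g′ p′ → j′ <ⁿ p′ → Occurs (shift j′ g′) (suc q′ ℕ.* p′) →
      n ≡ code-length g′ p′ q′ j′ → applyUpTo (shift j g) (suc q ℕ.* p) ≡ applyUpTo (shift j′ g′) (suc q′ ℕ.* p′)
    align refl lyn′ j′<p occ′ len =
      same-period⇒same-window {q = q} {q′} lyn lyn′ 0<q j<p j′<p occ occ′ len g≈g′

-- Words as prefixes of streams

-- The default 0 is harmless: `Occurs` keeps each window within the length of the word.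
nth : List ℕ → Stream
nth []       _       = 0
nth (x ∷ xs) zero    = x
nth (x ∷ xs) (suc k) = nth xs k

applyUpTo-nth : ∀ xs → applyUpTo (nth xs) (length xs) ≡ xs
applyUpTo-nth []       = refl
applyUpTo-nth (x ∷ xs) = cong (x ∷_) (applyUpTo-nth xs)

nth-++ˡ : ∀ xs {ys} → nth (xs ++ ys) ≈[ length xs ] nth xs
nth-++ˡ (x ∷ xs) {k = zero}  _         = refl
nth-++ˡ (x ∷ xs) {k = suc k} (s≤s k<n) = nth-++ˡ xs k<n

nth-++ʳ : ∀ xs {ys} k → nth (xs ++ ys) (length xs ∔ k) ≡ nth ys k
nth-++ʳ []       k = refl
nth-++ʳ (x ∷ xs) k = nth-++ʳ xs k

square-code : ∀ W N x → 0 <ⁿ length x → Occurs W N (nth (x ++ x)) (length x ∔ length x) → ∃ (Code W N (x ++ x))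
square-code W N x 0<L occ = code (lyndon-root 0<L cycle-periodic)
  where
  L = length x
  instance _ = ℕ.>-nonZero 0<L
  cycle : Stream
  cycle k = nth x (k % L)
  cycle-periodic : Periodic cycle L
  cycle-periodic k = cong (nth x) (trans (cong (_% L) (+-comm L k)) ([m+n]%n≡m%n k L))
  square≈cycle : nth (x ++ x) ≈[ L ∔ L ] cycle
  square≈cycle {k} k<2L with k <? L
  ... | yes k<L = trans (nth-++ˡ x k<L) (cong (nth x) (sym (m<n⇒m%n≡m k<L)))
  ... | no k≮L with m , refl ← m≤n⇒∃[o]m+o≡n (≮⇒≥ k≮L) =
    trans (nth-++ʳ x m) (trans (cong (nth x) (sym (m<n⇒m%n≡m (+-cancelˡ-< L m L k<2L)))) (sym (cycle-periodic m)))
  code : (∃₂ λ g p → LyndonPower g p × (∃ λ m → L ≡ suc m ℕ.* p) × (∃ λ j → j <ⁿ p × (∀ k → cycle k ≡ g (j ∔ k)))) →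
    ∃ (Code W N (x ++ x))
  code (g , p , lyn , (m , L≡) , j , j<p , cycle≗) =
    -- With L = (m + 1) p the square is a power of exponent 2 (m + 1), so q = 2 m + 1.
    _ , g , p , m ∔ suc m , j , lyn , ≤-trans (s≤s z≤n) (m≤n+m (suc m) m) , j<p
    , subst (Occurs W N (shift j g)) 2L≡ (occurs-cong W N square≈ occ)
    , prefix , refl
    where
    2L≡ : L ∔ L ≡ suc (m ∔ suc m) ℕ.* p
    2L≡ = trans (cong₂ _∔_ L≡ L≡) (sym (*-distribʳ-+ p (suc m) (suc m)))
    square≈ : nth (x ++ x) ≈[ L ∔ L ] shift j g
    square≈ k<2L = trans (square≈cycle k<2L) (cycle≗ _)
    prefix : x ++ x ≡ applyUpTo (shift j g) (suc (m ∔ suc m) ℕ.* p)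
    prefix = begin
      x ++ x                                              ≡⟨ applyUpTo-nth (x ++ x) ⟨
      applyUpTo (nth (x ++ x)) (length (x ++ x))          ≡⟨ cong (applyUpTo (nth (x ++ x))) (length-++ x) ⟩
      applyUpTo (nth (x ++ x)) (L ∔ L)                    ≡⟨ applyUpTo-cong (L ∔ L) square≈ ⟩
      applyUpTo (shift j g) (L ∔ L)                       ≡⟨ cong (applyUpTo (shift j g)) 2L≡ ⟩
      applyUpTo (shift j g) (suc (m ∔ suc m) ℕ.* p)       ∎
      where open ≡-Reasoning

-- Encoding an arbitrary alphabet in the natural numbers

module _ {a} {A : Set a} where

  factor-occurs : ∀ (e : A → ℕ) {u w} → Factor u w → Occurs (nth (map e w)) (length w) (nth (map e u)) (length u)
  factor-occurs e {u} (p , s , refl) = length p , fits , matches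
    where
    fits : length p ∔ length u ≤ⁿ length (p ++ u ++ s)
    fits = begin
      length p ∔ length u                ≤⟨ +-monoʳ-≤ (length p) (m≤m+n (length u) (length s)) ⟩
      length p ∔ (length u ∔ length s)   ≡⟨ cong (length p ∔_) (length-++ u) ⟨
      length p ∔ length (u ++ s)         ≡⟨ length-++ p ⟨
      length (p ++ u ++ s)               ∎
      where open ≤-Reasoning
    matches : shift (length p) (nth (map e (p ++ u ++ s))) ≈[ length u ] nth (map e u)
    matches {k} k<u = begin
      nth (map e (p ++ u ++ s)) (length p ∔ k)                    ≡⟨ cong₂ nth (map-++ e p (u ++ s))
                                                                       (cong (_∔ k) (sym (length-map e p))) ⟩
      nth (map e p ++ map e (u ++ s)) (length (map e p) ∔ k)      ≡⟨ nth-++ʳ (map e p) k ⟩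
      nth (map e (u ++ s)) k                                      ≡⟨ cong (λ v → nth v k) (map-++ e u s) ⟩
      nth (map e u ++ map e s) k                                  ≡⟨ nth-++ˡ (map e u) (subst (k <ⁿ_) (sym (length-map e u)) k<u) ⟩
      nth (map e u) k                                             ∎
      where open ≡-Reasoning

  factor-⊆ : ∀ {u w : Word A} → Factor u w → ∀ {b} → b ∈ u → b ∈ w
  factor-⊆ (p , s , refl) b∈ = ∈-++⁺ʳ p (∈-++⁺ˡ b∈)

  map-injective-on : ∀ {w : Word A} (e : A → ℕ) → (∀ {b c} → b ∈ w → c ∈ w → e b ≡ e c → b ≡ c) →
    ∀ {u v} → (∀ {b} → b ∈ u → b ∈ w) → (∀ {b} → b ∈ v → b ∈ w) → map e u ≡ map e v → u ≡ v
  map-injective-on e inj {[]}    {[]}    _  _  _  = refl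
  map-injective-on e inj {b ∷ u} {c ∷ v} u⊆ v⊆ eq = cong₂ _∷_
    (inj (u⊆ (here refl)) (v⊆ (here refl)) (∷-injectiveˡ eq))
    (map-injective-on e inj (u⊆ ∘ there) (v⊆ ∘ there) (∷-injectiveʳ eq))

module _ {a} {A : Set a} (_≟ᴬ_ : DecidableEquality A) where

  -- The Lyndon argument needs ordered letters; first positions in the word supply an order from
  -- decidable equality alone.
  firstIndex : Word A → A → ℕ
  firstIndex []       b = 0
  firstIndex (x ∷ xs) b = if does (b ≟ᴬ x) then 0 else suc (firstIndex xs b)

  firstIndex-injective : ∀ w {b c} → b ∈ w → c ∈ w → firstIndex w b ≡ firstIndex w c → b ≡ c
  firstIndex-injective (x ∷ w) {b} {c} b∈ c∈ eq with b ≟ᴬ x | c ≟ᴬ x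
  ... | yes refl | yes refl = refl
  ... | no b≢x   | no c≢x   = firstIndex-injective w (tail b∈ b≢x) (tail c∈ c≢x) (suc-injective eq)
    where
    tail : ∀ {b} → b ∈ x ∷ w → ¬ b ≡ x → b ∈ w
    tail (here b≡x) b≢x = contradiction b≡x b≢x
    tail (there b∈) _   = b∈

  module _ (w : Word A) where

    private
      e = firstIndex w
      W = nth (map e w)
      N = length w

      factor⁻ : ∀ {u} → u ∈ squareFactors _≟ᴬ_ w → Factor u w
      factor⁻ u∈ = proj₂ (Equivalence.to (∈-squareFactors _≟ᴬ_ _ w) u∈)

    squares-≤ : ∀ {zs} → (∀ {n z} → suc n ≤ⁿ N → Special W N n z → z ∈ zs) → S _≟ᴬ_ w ≤ⁿ suc (length zs)
    squares-≤ {zs} zs∋ = relation-length-≤ R (squareFactors-unique _≟ᴬ_ w) total injective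
      where
      R : Word A → List ℕ → Set a
      -- The empty square has no code and is sent to `[]`, which is not a special edge. This one
      -- extra value is the successor in the bound.
      R u z = (u ≡ [] × z ≡ []) ⊎ (¬ z ≡ [] × Code W N (map e u) z)

      total : ∀ {u} → u ∈ squareFactors _≟ᴬ_ w → ∃ λ z → z ∈ [] ∷ zs × R u z
      total {u} u∈ = choose (Equivalence.to (∈-squareFactors _≟ᴬ_ u w) u∈)
        where
        nonempty : ∀ {n z} → Special W N n z → ¬ z ≡ []
        nonempty (_ , _ , _ , _ , _ , refl) ()

        coded : ∀ {v} → ∃ (Code W N (map e v ++ map e v)) → ∃ λ z → z ∈ [] ∷ zs × R (v ++ v) z
        coded {v} (z , code) = z , there (zs∋ (special-length W N special) special)
          , inj₂ (nonempty special , subst (λ x → Code W N x z) (sym (map-++ e v v)) code)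
          where
          special : Special W N _ z
          special = proj₂ (code-special W N code)

        choose : ∀ {u} → Square u × Factor u w → ∃ λ z → z ∈ [] ∷ zs × R u z
        choose (([] , refl) , _) = [] , here refl , inj₁ (refl , refl)
        choose ((v@(_ ∷ _) , refl) , factor) = coded {v} (square-code W N (map e v) (s≤s z≤n)
          (subst₂ (Occurs W N) (cong nth (map-++ e v v))
            (trans (length-++ v) (sym (cong₂ _∔_ (length-map e v) (length-map e v))))
            (factor-occurs e factor)))

      injective : ∀ {u u′ z} → u ∈ squareFactors _≟ᴬ_ w → u′ ∈ squareFactors _≟ᴬ_ w → R u z → R u′ z → u ≡ u′
      injective _  _   (inj₁ (refl , _))  (inj₁ (refl , _))  = refl
      injective _  _   (inj₁ (_ , z≡[]))  (inj₂ (z≢[] , _))  = contradiction z≡[] z≢[]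
      injective _  _   (inj₂ (z≢[] , _))  (inj₁ (_ , z≡[]))  = contradiction z≡[] z≢[]
      injective u∈ u′∈ (inj₂ (_ , code))  (inj₂ (_ , code′)) =
        map-injective-on e (firstIndex-injective w) (factor-⊆ (factor⁻ u∈)) (factor-⊆ (factor⁻ u′∈))
          (code-injective W N code code′)

    letters-≤ : length (Alph _≟ᴬ_ w) ≤ⁿ length (words W N 1)
    letters-≤ = relation-length-≤ (λ b z → z ≡ e b ∷ []) (Alph-unique _≟ᴬ_ w) total injective
      where
      ∈w : ∀ {b} → b ∈ Alph _≟ᴬ_ w → b ∈ w
      ∈w {b} = Equivalence.to (∈-Alph _≟ᴬ_ b w)

      total : ∀ {b} → b ∈ Alph _≟ᴬ_ w → ∃ λ z → z ∈ words W N 1 × z ≡ e b ∷ []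
      total {b} b∈ with p , s , w≡ ← ∈-∃++ (∈w b∈) =
        e b ∷ [] , ∈-words⁺ W N (factor-occurs e {b ∷ []} (p , s , w≡)) , refl

      injective : ∀ {b c z} → b ∈ Alph _≟ᴬ_ w → c ∈ Alph _≟ᴬ_ w → z ≡ e b ∷ [] → z ≡ e c ∷ [] → b ≡ c
      injective b∈ c∈ z≡ z≡′ = firstIndex-injective w (∈w b∈) (∈w c∈) (∷-injectiveˡ (trans (sym z≡) z≡′))

  -- The inequality over the naturals and over the integers

  squares+letters-≤ : ∀ w → S _≟ᴬ_ w ∔ length (Alph _≟ᴬ_ w) ≤ⁿ suc (length w)
  squares+letters-≤ []        = ≤-refl
  -- Stability of the decidable goal absorbs the double negation of `levels`. For nonempty `w`,
  -- `length t` is N - 1, the largest order whose graph has edges.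
  squares+letters-≤ w@(_ ∷ t) = decidable-stable (_ ≤? _) λ ¬goal →
    levels (nth (map (firstIndex w) w)) (length w) (length t) λ (zs , zs≤ , zs∋) → ¬goal (bound zs zs≤ zs∋)
    where
    W = nth (map (firstIndex w) w)
    N = length w
    bound : ∀ zs → length zs ∔ length (words W N 1) ≤ⁿ length (words W N N) ∔ length t →
      (∀ {n z} → n ≤ⁿ length t → Special W N n z → z ∈ zs) → S _≟ᴬ_ w ∔ length (Alph _≟ᴬ_ w) ≤ⁿ suc N
    bound zs zs≤ zs∋ = begin
      S _≟ᴬ_ w ∔ length (Alph _≟ᴬ_ w)             ≤⟨ +-mono-≤ (squares-≤ w λ n<N → zs∋ (≤-pred n<N)) (letters-≤ w) ⟩
      suc (length zs ∔ length (words W N 1))      ≤⟨ s≤s zs≤ ⟩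
      -- There is at most one factor of full length N.
      suc (length (words W N N) ∔ length t)       ≤⟨ s≤s (+-monoˡ-≤ (length t) (≤-trans (words-length W N N)
                                                       (≤-reflexive (m+n∸n≡m 1 N)))) ⟩
      suc N                                       ∎
      where open ≤-Reasoning

theorem1 : ∀ {a} {A : Set a} (_≟_ : DecidableEquality A) (w : Word A) →
    + S _≟_ w ≤ + length w - + length (Alph _≟_ w) + + 1
theorem1 _≟_ w = begin
  + S _≟_ w                       ≤⟨ +≤+ (m+n≤o⇒m≤o∸n (S _≟_ w) (squares+letters-≤ _≟_ w)) ⟩
  -- Truncated subtraction is exact here, because a word has at most as many distinct letters as
  -- positions.
  + (suc (length w) ∸ k)          ≡⟨ cong +_ (+-∸-assoc 1 k≤) ⟩
  + suc (length w ∸ k)            ≡⟨ cong +_ (+-comm 1 (length w ∸ k)) ⟩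
  + (length w ∸ k) + + 1          ≡⟨ cong (_+ + 1) (ℤ.⊖-≥ k≤) ⟨
  (length w ⊖ k) + + 1            ≡⟨ cong (_+ + 1) (ℤ.[+m]-[+n]≡m⊖n (length w) k) ⟨
  + length w - + k + + 1          ∎
  where
  open ℤ.≤-Reasoning
  k = length (Alph _≟_ w)
  k≤ : k ≤ⁿ length w
  k≤ = length-deduplicate _≟_ w
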